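{- Let $G$ be the infinite planar graph of the chair tiling in which every tile is given 8 vertices. Then $G$ is bipartite and thus 2-colourable; its chromatic number is $\chi(G)=2$.
   Context: Chair substitution. The prototile is the L-shaped polygon $C=\overline{[0,2]^2\setminus[1,2]^2}$ (a union of three unit squares). The substitution $\omega$ replaces $C$ by the dissection of $2C=\overline{[0,4]^2\setminus[2,4]^2}$ into four tiles congruent to $C$: the tile $C$; the tile $C+(1,1)$; the tile $\overline{[0,2]\times[2,4]\setminus[1,2]\times[2,3]}$; and the tile $\overline{[2,4]\times[0,2]\setminus[2,3]\times[1,2]}$. It is extended to translates and rotations (by multiples of $90^\circ$) of $C$, and to collections of such tiles, in the obvious covariant way (expand by the factor 2, then dissect each expanded tile). The chair tiling is the fixed point tiling of the plane produced by this substitution. Graph with 8 vertices per tile: the 8 vertices of the tile $C$ are $(0,0),(1,0),(2,0),(2,1),(1,1),(1,2),(0,2),(0,1)$, and correspondingly for every translated or rotated tile. The edges are the unit segments of the tile boundaries joining consecutive vertices, and the faces are the tiles. -}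

module Defs where

import Algebra.Properties.AbelianGroup as GroupProperties
open import Data.Fin.Base as Fin using (Fin; toℕ)
open import Data.Fin.Patterns using (0F; 1F; 2F; 3F)
import Data.Fin.Properties as Fin
open import Data.Integer.Base as ℤ using (ℤ; +_; -[1+_]; 0ℤ; 1ℤ)
import Data.Integer.Properties as ℤ
open import Data.Integer.Tactic.RingSolver using (solve-∀)
open import Data.List.Base using (List; []; _∷_; _++_; map; zip; drop; take; cartesianProduct)
open import Data.List.Membership.Propositional using (_∈_; find)
open import Data.List.Membership.Propositional.Properties
  using (∈-map⁺; ∈-map⁻; ∈-cartesianProduct⁺)
import Data.List.Membership.DecPropositional as DecMembership
open import Data.List.Relation.Unary.All as All using (All)
open import Data.List.Relation.Unary.Any as Any using (Any; here; there; any?)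
open import Data.Nat.Base as ℕ using (ℕ; zero; suc; ⌊_/2⌋)
open import Data.Nat.GeneralisedArithmetic using (fold)
open import Data.Nat.Induction using (<-rec)
import Data.Nat.Properties as ℕ
open import Data.Product using (_×_; _,_; proj₁; proj₂; ∃; ∃-syntax)
open import Data.Product.Properties using (≡-dec)
open import Data.Refinement using (Refinement; value)
open import Data.Sum.Base as Sum using (_⊎_; inj₁; inj₂)
open import Data.Unit.Base using (tt)
open import Level using (0ℓ)
open import Relation.Binary.Core using (Rel)
open import Relation.Binary.Definitions using (Symmetric; Irreflexive; DecidableEquality)
open import Relation.Binary.PropositionalEquality
open import Relation.Nullary.Decidable using (toWitness; _→-dec_; ¬?)
open import Relation.Nullary.Negation using (¬_)
open import Relation.Unary using (Pred; _≐_; _⊆_)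

record Graph : Set₁ where
  field
    Vertex    : Set
    _~_       : Rel Vertex 0ℓ
    ~-sym     : Symmetric _~_
    ~-irrefl  : Irreflexive _≡_ _~_

module _ (G : Graph) where
  open Graph G

  record Bipartite : Set₁ where
    field
      A B       : Pred Vertex 0ℓ
      covers    : ∀ v → A v ⊎ B v
      disjoint  : ∀ v → ¬ (A v × B v)
      no-edge-A : ∀ {u v} → A u → A v → ¬ (u ~ v)
      no-edge-B : ∀ {u v} → B u → B v → ¬ (u ~ v)

  Colourable : ℕ → Set
  Colourable k = ∃ λ (c : Vertex → Fin k) → ∀ {u v} → u ~ v → c u ≢ c v

  HasChromaticNumber : ℕ → Set
  HasChromaticNumber k = Colourable k × (∀ m → Colourable m → k ℕ.≤ m)

Point : Set
Point = ℤ × ℤ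

infixl 6 _⊕_
_⊕_ : Point → Point → Point
(x , y) ⊕ (x′ , y′) = x ℤ.+ x′ , y ℤ.+ y′

double : Point → Point
double v = v ⊕ v

-- Rotation about the origin by 90° counterclockwise.
turn : Point → Point
turn (x , y) = ℤ.- y , x

-- (k , v) stands for the tile Rᵏ C + v, where R is `turn`.  Every tile the
-- substitution produces from rotations of C about the origin has this form,
-- and, as C has no rotational symmetry, in exactly one way.
Tile : Set
Tile = Fin 4 × Point

C : Tile
C = 0F , 0ℤ , 0ℤ

translate : Point → Tile → Tile
translate v (k , w) = k , v ⊕ w

next : Fin 4 → Fin 4
next 0F = 1F
next 1F = 2F
next 2F = 3F
next 3F = 0F

-- R (Rᵏ C + v) = Rᵏ⁺¹ C + R v
turnTile : Tile → Tile
turnTile (k , v) = next k , turn v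

-- The vertices of C in cyclic order along its boundary.
outline : List Point
outline = (+ 0 , + 0) ∷ (+ 1 , + 0) ∷ (+ 2 , + 0) ∷ (+ 2 , + 1)
        ∷ (+ 1 , + 1) ∷ (+ 1 , + 2) ∷ (+ 0 , + 2) ∷ (+ 0 , + 1) ∷ []

sides : List (Point × Point)
sides = zip outline (drop 1 outline ++ take 1 outline)

-- The isometry p ↦ Rᵏ p + v, which carries C to the tile.
place : Tile → Point → Point
place (k , v) p = v ⊕ fold p turn (toℕ k)

vertices : Tile → List Point
vertices t = map (place t) outline

edges : Tile → List (Point × Point)
edges t = map (λ (p , q) → place t p , place t q) sides

-- A cell (x , y) is the unit square [x,x+1]×[y,y+1]; `turn` carries it to
-- [-y-1,-y]×[x,x+1].
turnCell : Point → Point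
turnCell (x , y) = ℤ.- ℤ.suc y , x

placeCell : Tile → Point → Point
placeCell (k , v) c = v ⊕ fold c turnCell (toℕ k)

cells : Tile → List Point
cells t = map (placeCell t) ((+ 0 , + 0) ∷ (+ 1 , + 0) ∷ (+ 0 , + 1) ∷ [])

-- The dissection of 2C.  In the third tile the missing unit square is at the
-- lower right, which is R³ C moved by (0,4); in the fourth it is at the upper
-- left, which is R C moved by (4,0).
dissection : List Tile
dissection = C
           ∷ translate (+ 1 , + 1) C
           ∷ (3F , + 0 , + 4)
           ∷ (1F , + 4 , + 0)
           ∷ []

-- 2 (Rᵏ C + v) = Rᵏ (2C) + 2v
ω : Tile → List Tile
ω (k , v) = map (λ t → translate (double v) (fold t turnTile (toℕ k))) dissection

Collection : Set₁
Collection = Pred Tile 0ℓ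

Ω : Collection → Collection
Ω T t = ∃[ s ] T s × t ∈ ω s

-- All tiles are unions of cells, so a collection tiles the plane exactly when
-- each cell lies in one and only one of its tiles.
record IsTiling (T : Collection) : Set where
  field
    covers   : ∀ c → ∃[ t ] T t × c ∈ cells t
    disjoint : ∀ {s t c} → T s → T t → c ∈ cells s → c ∈ cells t → s ≡ t

-- Which tiling is "the" fixed point depends on the tiles chosen around the
-- origin; the predicate admits every choice.  `chairTiling` below, generated
-- from the four rotations of C about the origin, is one instance.
record IsFixedPointTiling (T : Collection) : Set where
  field
    isTiling : IsTiling T
    fixed    : Ω T ≐ T

IsVertex : Collection → Pred Point 0ℓ
IsVertex T p = ∃[ t ] T t × p ∈ vertices t

Adjacent : Collection → Rel Point 0ℓ
Adjacent T p q = ∃[ t ] T t × ((p , q) ∈ edges t ⊎ (q , p) ∈ edges t)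

private
  module ℤ-Group = GroupProperties ℤ.+-0-abelianGroup

  _≟ₚ_ : DecidableEquality Point
  _≟ₚ_ = ≡-dec ℤ._≟_ ℤ._≟_

  _≟ₜ_ : DecidableEquality Tile
  _≟ₜ_ = ≡-dec Fin._≟_ _≟ₚ_

  open DecMembership _≟ₚ_ using (_∈?_)

  0ₚ : Point
  0ₚ = 0ℤ , 0ℤ

  ⊕-assoc : ∀ u v w → (u ⊕ v) ⊕ w ≡ u ⊕ (v ⊕ w)
  ⊕-assoc (a , b) (c , d) (e , f) = cong₂ _,_ (ℤ.+-assoc a c e) (ℤ.+-assoc b d f)

  ⊕-cancelˡ : ∀ u {v w} → u ⊕ v ≡ u ⊕ w → v ≡ w
  ⊕-cancelˡ (a , b) eq = cong₂ _,_ (ℤ-Group.∙-cancelˡ a _ _ (cong proj₁ eq))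
                                    (ℤ-Group.∙-cancelˡ b _ _ (cong proj₂ eq))

  ⊕-identityʳ : ∀ v → v ⊕ 0ₚ ≡ v
  ⊕-identityʳ (a , b) = cong₂ _,_ (ℤ.+-identityʳ a) (ℤ.+-identityʳ b)

  edge-noLoop : ∀ t {p} → ¬ ((p , p) ∈ edges t)
  edge-noLoop t@(k , v) m with ∈-map⁻ (λ (p , q) → place t p , place t q) m
  ... | _ , s∈ , eq =
    All.lookup (check k) s∈ (⊕-cancelˡ v (trans (sym (cong proj₁ eq)) (cong proj₂ eq)))
    where
    check : ∀ k → All (λ e → fold (proj₁ e) turn (toℕ k) ≢ fold (proj₂ e) turn (toℕ k)) sides
    check = toWitness {a? = Fin.all? λ k → All.all? (λ e →
              ¬? (fold (proj₁ e) turn (toℕ k) ≟ₚ fold (proj₂ e) turn (toℕ k))) sides} tt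

-- The membership proof in `Refinement` is irrelevant, so a vertex shared by
-- several tiles is a single vertex of the graph.
graphOf : Collection → Graph
graphOf T = record
  { Vertex   = Refinement Point (IsVertex T)
  ; _~_      = λ u v → Adjacent T (value u) (value v)
  ; ~-sym    = λ (t , t∈T , e) → t , t∈T , Sum.swap e
  ; ~-irrefl = λ { refl (t , _ , inj₁ e) → edge-noLoop t e
                 ; refl (t , _ , inj₂ e) → edge-noLoop t e }
  }

seed : Collection
seed (k , v) = v ≡ (0ℤ , 0ℤ)

level : ℕ → Collection
level n = fold seed Ω n

chairTiling : Collection
chairTiling t = ∃[ n ] level n t

private
  halfℤ : ℤ → ℤ
  halfℤ (+ n)    = + ⌊ n /2⌋
  halfℤ -[1+ n ] = -[1+ ⌊ n /2⌋ ]

  bits : List ℤ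
  bits = 0ℤ ∷ 1ℤ ∷ []

  ⌊1+n+n/2⌋ : ∀ n → ⌊ suc (n ℕ.+ n) /2⌋ ≡ n
  ⌊1+n+n/2⌋ zero = refl
  ⌊1+n+n/2⌋ (suc n) rewrite ℕ.+-suc n n = cong suc (⌊1+n+n/2⌋ n)

  halfℤ-bit : ∀ h {b} → b ∈ bits → halfℤ (h ℤ.+ h ℤ.+ b) ≡ h
  halfℤ-bit (+ n) (here refl) =
    cong +_ (trans (cong ⌊_/2⌋ (ℕ.+-identityʳ _)) (sym (ℕ.n≡⌊n+n/2⌋ n)))
  halfℤ-bit (+ n) (there (here refl)) =
    cong +_ (trans (cong ⌊_/2⌋ (ℕ.+-comm (n ℕ.+ n) 1)) (⌊1+n+n/2⌋ n))
  halfℤ-bit -[1+ n ] (here refl) = cong -[1+_] (⌊1+n+n/2⌋ n)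
  halfℤ-bit -[1+ n ] (there (here refl)) = cong -[1+_] (sym (ℕ.n≡⌊n+n/2⌋ n))

  Split : ℤ → Set
  Split x = ∃[ b ] b ∈ bits × x ≡ halfℤ x ℤ.+ halfℤ x ℤ.+ b

  suc-suc : ∀ n x b → + n ≡ x ℤ.+ x ℤ.+ b →
            + suc (suc n) ≡ (1ℤ ℤ.+ x) ℤ.+ (1ℤ ℤ.+ x) ℤ.+ b
  suc-suc n x b eq = trans (cong (ℤ._+_ (+ 2)) eq) (shift x b)
    where
    shift : ∀ x b → + 2 ℤ.+ (x ℤ.+ x ℤ.+ b) ≡ (1ℤ ℤ.+ x) ℤ.+ (1ℤ ℤ.+ x) ℤ.+ b
    shift = solve-∀

  pred-pred : ∀ n m b → -[1+ n ] ≡ -[1+ m ] ℤ.+ -[1+ m ] ℤ.+ b →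
              -[1+ suc (suc n) ] ≡ -[1+ suc m ] ℤ.+ -[1+ suc m ] ℤ.+ b
  pred-pred n m b eq = trans (cong (ℤ._+_ (-[1+ 1 ])) eq) (shift -[1+ m ] b)
    where
    shift : ∀ x b → -[1+ 1 ] ℤ.+ (x ℤ.+ x ℤ.+ b) ≡ (-[1+ 0 ] ℤ.+ x) ℤ.+ (-[1+ 0 ] ℤ.+ x) ℤ.+ b
    shift = solve-∀

  split : ∀ x → Split x
  split (+ 0)           = 0ℤ , here refl , refl
  split (+ 1)           = 1ℤ , there (here refl) , refl
  split (+ suc (suc n)) with split (+ n)
  ... | b , b∈ , eq     = b , b∈ , suc-suc n (+ ⌊ n /2⌋) b eq
  split -[1+ 0 ]        = 1ℤ , there (here refl) , refl
  split -[1+ 1 ]        = 0ℤ , here refl , refl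
  split -[1+ suc (suc n) ] with split -[1+ n ]
  ... | b , b∈ , eq     = b , b∈ , pred-pred n ⌊ n /2⌋ b eq

  halfℤ-shift : ∀ v c → halfℤ (v ℤ.+ v ℤ.+ c) ≡ v ℤ.+ halfℤ c
  halfℤ-shift v c with split c
  ... | b , b∈ , eq = trans (cong halfℤ (trans (cong (ℤ._+_ (v ℤ.+ v)) eq) (regroup v (halfℤ c) b)))
                            (halfℤ-bit (v ℤ.+ halfℤ c) b∈)
    where
    regroup : ∀ v h b → v ℤ.+ v ℤ.+ (h ℤ.+ h ℤ.+ b) ≡ (v ℤ.+ h) ℤ.+ (v ℤ.+ h) ℤ.+ b
    regroup = solve-∀

  half : Point → Point
  half (x , y) = halfℤ x , halfℤ y

  half-shift : ∀ v c → half (double v ⊕ c) ≡ v ⊕ half c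
  half-shift (a , b) (x , y) = cong₂ _,_ (halfℤ-shift a x) (halfℤ-shift b y)

  turns : Fin 4 → Tile → Tile
  turns k t = fold t turnTile (toℕ k)

  ω₀ : Fin 4 → List Tile
  ω₀ k = map (turns k) dissection

  ω⁺ : ∀ {k t} v → t ∈ ω₀ k → translate (double v) t ∈ ω (k , v)
  ω⁺ {k} v m with ∈-map⁻ (turns k) m
  ... | _ , d∈ , refl = ∈-map⁺ (λ t → translate (double v) (turns k t)) d∈

  ω⁻ : ∀ {k v t} → t ∈ ω (k , v) → ∃[ t₀ ] t₀ ∈ ω₀ k × t ≡ translate (double v) t₀
  ω⁻ {k} {v} m with ∈-map⁻ (λ t → translate (double v) (turns k t)) m
  ... | _ , d∈ , refl = _ , ∈-map⁺ (turns k) d∈ , refl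

  cells⁺ : ∀ u t {c} → c ∈ cells t → u ⊕ c ∈ cells (translate u t)
  cells⁺ u t@(k , w) m with ∈-map⁻ (placeCell t) m
  ... | e , e∈ , refl =
    subst (_∈ cells (k , u ⊕ w)) (⊕-assoc u w _) (∈-map⁺ (placeCell (k , u ⊕ w)) e∈)

  cells⁻ : ∀ u t {c} → c ∈ cells (translate u t) → ∃[ c₀ ] c₀ ∈ cells t × c ≡ u ⊕ c₀
  cells⁻ u t@(k , w) m with ∈-map⁻ (placeCell (k , u ⊕ w)) m
  ... | e , e∈ , refl = _ , ∈-map⁺ (placeCell t) e∈ , ⊕-assoc u w _

  bits² : List Point
  bits² = cartesianProduct bits bits

  parent₀ : ∀ k → All (λ t → All (λ c → half c ∈ cells (k , 0ₚ)) (cells t)) (ω₀ k)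
  parent₀ = toWitness {a? = Fin.all? λ k → All.all? (λ t → All.all? (λ c → half c ∈? cells (k , 0ₚ)) (cells t)) (ω₀ k)} tt

  unique₀ : ∀ k → All (λ s → All (λ t → All (λ c → c ∈ cells t → s ≡ t) (cells s)) (ω₀ k)) (ω₀ k)
  unique₀ = toWitness {a? = Fin.all? λ k → All.all? (λ s → All.all? (λ t →
              All.all? (λ c → (c ∈? cells t) →-dec (s ≟ₜ t)) (cells s)) (ω₀ k)) (ω₀ k)} tt

  child₀ : ∀ k → All (λ h → All (λ b → Any (λ t → double h ⊕ b ∈ cells t) (ω₀ k)) bits²) (cells (k , 0ₚ))
  child₀ = toWitness {a? = Fin.all? λ k → All.all? (λ h → All.all? (λ b →
             any? (λ t → (double h ⊕ b) ∈? cells t) (ω₀ k)) bits²) (cells (k , 0ₚ))} tt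

  child₁ : ∀ k {h b} → h ∈ cells (k , 0ₚ) → b ∈ bits² → ∃[ t ] t ∈ ω₀ k × (double h ⊕ b) ∈ cells t
  child₁ k h∈ b∈ = find (All.lookup (All.lookup (child₀ k) h∈) b∈)

  seed-unique : ∀ j k → All (λ c → c ∈ cells (k , 0ₚ) → j ≡ k) (cells (j , 0ₚ))
  seed-unique = toWitness {a? = Fin.all? λ j → Fin.all? λ k →
                  All.all? (λ c → (c ∈? cells (k , 0ₚ)) →-dec (j Fin.≟ k)) (cells (j , 0ₚ))} tt

  seed-fixed : ∀ k → Any (_≡ (k , 0ₚ)) (ω (k , 0ₚ))
  seed-fixed = toWitness {a? = Fin.all? λ k → any? (_≟ₜ (k , 0ₚ)) (ω (k , 0ₚ))} tt

  atOrigin : ∀ k v → translate v (k , 0ₚ) ≡ (k , v)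
  atOrigin k v = cong (k ,_) (⊕-identityʳ v)

  parent : ∀ {s t c} → t ∈ ω s → c ∈ cells t → half c ∈ cells s
  parent {k , v} t∈ c∈ with ω⁻ {k} {v} t∈
  ... | t₀ , t₀∈ , refl with cells⁻ (double v) t₀ c∈
  ... | c₀ , c₀∈ , refl =
    subst₂ (λ h s → h ∈ cells s) (sym (half-shift v c₀)) (atOrigin k v)
      (cells⁺ v (k , 0ₚ) (All.lookup (All.lookup (parent₀ k) t₀∈) c₀∈))

  unique : ∀ {r s t c} → s ∈ ω r → t ∈ ω r → c ∈ cells s → c ∈ cells t → s ≡ t
  unique {k , v} s∈ t∈ c∈s c∈t with ω⁻ {k} {v} s∈ | ω⁻ {k} {v} t∈
  ... | s₀ , s₀∈ , refl | t₀ , t₀∈ , refl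
    with cells⁻ (double v) s₀ c∈s | cells⁻ (double v) t₀ c∈t
  ... | c₀ , c₀∈ , refl | c₁ , c₁∈ , eq =
    cong (translate (double v))
      (All.lookup (All.lookup (All.lookup (unique₀ k) s₀∈) t₀∈) c₀∈
        (subst (_∈ cells t₀) (sym (⊕-cancelˡ (double v) eq)) c₁∈))

  regroup : ∀ v h b → double v ⊕ (double h ⊕ b) ≡ double (v ⊕ h) ⊕ b
  regroup (a , b) (c , d) (e , f) = cong₂ _,_ (regroup₁ a c e) (regroup₁ b d f)
    where
    regroup₁ : ∀ v h b → v ℤ.+ v ℤ.+ (h ℤ.+ h ℤ.+ b) ≡ (v ℤ.+ h) ℤ.+ (v ℤ.+ h) ℤ.+ b
    regroup₁ = solve-∀

  Child : Tile → Point → Point → Set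
  Child s h b = ∃[ t ] t ∈ ω s × double h ⊕ b ∈ cells t

  child₂ : ∀ k v h b → h ∈ cells (k , 0ₚ) → b ∈ bits² → Child (k , v) (v ⊕ h) b
  child₂ k v h b h∈ b∈ =
    let t , t∈ , c∈ = child₁ k h∈ b∈
    in translate (double v) t , ω⁺ {k} v t∈
     , subst (λ c → c ∈ cells (translate (double v) t)) (regroup v h b) (cells⁺ (double v) t c∈)

  child : ∀ s h b → h ∈ cells s → b ∈ bits² → Child s h b
  child (k , v) h b h∈ b∈ =
    let h₀ , h₀∈ , eq = cells⁻ v (k , 0ₚ) (subst (λ s → h ∈ cells s) (sym (atOrigin k v)) h∈)
    in subst (λ h → Child (k , v) h b) (sym eq) (child₂ k v h₀ b h₀∈ b∈)

  level-mono : ∀ n → level n ⊆ level (suc n)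
  level-mono zero {k , _} refl = (k , 0ₚ) , refl , Any.map sym (seed-fixed k)
  level-mono (suc n) (s , s∈ , t∈) = s , level-mono n s∈ , t∈

  level-+ : ∀ m n → level n ⊆ level (m ℕ.+ n)
  level-+ zero    n t∈ = t∈
  level-+ (suc m) n t∈ = level-mono (m ℕ.+ n) (level-+ m n t∈)

  level-disjoint : ∀ n {s t c} → level n s → level n t → c ∈ cells s → c ∈ cells t → s ≡ t
  level-disjoint zero {j , _} {k , _} refl refl c∈s c∈t =
    cong (_, 0ₚ) (All.lookup (seed-unique j k) c∈s c∈t)
  level-disjoint (suc n) (r , r∈ , s∈) (r′ , r′∈ , t∈) c∈s c∈t
    with level-disjoint n r∈ r′∈ (parent {r} s∈ c∈s) (parent {r′} t∈ c∈t)
  ... | refl = unique {r} s∈ t∈ c∈s c∈t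

  data Reached : ℕ → ℤ → Set where
    base₀ : Reached 0 0ℤ
    base₁ : Reached 0 -[1+ 0 ]
    step  : ∀ {n x} → Reached n (halfℤ x) → Reached (suc n) x

  reached-mono : ∀ {n x} → Reached n x → Reached (suc n) x
  reached-mono base₀    = step base₀
  reached-mono base₁    = step base₁
  reached-mono (step r) = step (reached-mono r)

  reached-+ : ∀ m {n x} → Reached n x → Reached (m ℕ.+ n) x
  reached-+ zero    r = r
  reached-+ (suc m) r = reached-mono (reached-+ m r)

  reach₊ : ∀ n → ∃[ k ] Reached k (+ n)
  reach₊ = <-rec _ λ { zero _ → 0 , base₀
                     ; (suc n) rec → let k , r = rec (ℕ.⌊n/2⌋<n n) in suc k , step r }

  reach₋ : ∀ n → ∃[ k ] Reached k -[1+ n ]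
  reach₋ = <-rec _ λ { zero _ → 0 , base₁
                     ; (suc n) rec → let k , r = rec (ℕ.⌊n/2⌋<n n) in suc k , step r }

  reach : ∀ x → ∃[ k ] Reached k x
  reach (+ n)    = reach₊ n
  reach -[1+ n ] = reach₋ n

  half-split : ∀ c → ∃[ b ] b ∈ bits² × c ≡ double (half c) ⊕ b
  half-split (x , y) with split x | split y
  ... | a , a∈ , eq | b , b∈ , eq′ = (a , b) , ∈-cartesianProduct⁺ a∈ b∈ , cong₂ _,_ eq eq′

  Covered : ℕ → Point → Set
  Covered n c = ∃[ t ] level n t × c ∈ cells t

  covered-step : ∀ n c → Covered n (half c) → Covered (suc n) c
  covered-step n c (s , s∈ , h∈) =
    let b , b∈ , eq = half-split c
        t , t∈ , c∈ = child s (half c) b h∈ b∈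
    in t , (s , s∈ , t∈) , subst (λ c → c ∈ cells t) (sym eq) c∈

  covered : ∀ n {x y} → Reached n x → Reached n y → Covered n (x , y)
  covered zero base₀ base₀ = (0F , 0ₚ) , refl , here refl
  covered zero base₁ base₀ = (1F , 0ₚ) , refl , here refl
  covered zero base₁ base₁ = (2F , 0ₚ) , refl , here refl
  covered zero base₀ base₁ = (3F , 0ₚ) , refl , here refl
  covered (suc n) (step p) (step q) = covered-step n _ (covered n p q)

chairTiling-isFixedPointTiling : IsFixedPointTiling chairTiling
chairTiling-isFixedPointTiling = record
  { isTiling = record
    { covers = λ (x , y) →
        let m , p = reach x
            n , q = reach y
            t , t∈ , c∈ = covered (m ℕ.+ n) (subst (λ k → Reached k x) (ℕ.+-comm n m) (reached-+ n p))
                                            (reached-+ m q)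
        in t , (m ℕ.+ n , t∈) , c∈
    ; disjoint = λ { {s} (m , s∈) (n , t∈) →
        level-disjoint (m ℕ.+ n) (subst (λ k → level k s) (ℕ.+-comm n m) (level-+ n m s∈))
                                 (level-+ m n t∈) }
    }
  ; fixed = (λ (s , (n , s∈) , t∈) → suc n , s , s∈ , t∈)
          , (λ (n , t∈) → let s , s∈ , t∈ω = level-mono n t∈ in s , (n , s∈) , t∈ω)
  }

{-# OPTIONS --safe #-}
-- Every edge of a tile is a unit segment between lattice points, so it joins
-- points whose coordinate sums have opposite parity.
module Submission where

open import Defs
open import Data.Empty using (⊥-elim)
open import Data.Fin.Base using (Fin; toℕ)
open import Data.Fin.Patterns using (0F; 1F)
open import Data.Fin.Properties using (all?)
open import Data.Integer.Base as ℤ using (ℤ; +_; -[1+_]; ∣_∣; _⊖_; 0ℤ)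
import Data.Integer.Properties as ℤ
open import Data.Irrelevant using ([_])
open import Data.List.Membership.Propositional using (_∈_)
open import Data.List.Membership.Propositional.Properties using (∈-map⁻)
open import Data.List.Relation.Unary.All as All using (All)
open import Data.List.Relation.Unary.Any using (here; there)
open import Data.Nat.Base as ℕ using (zero; suc; z≤n; s≤s; parity)
import Data.Nat.Properties as ℕ
open import Data.Nat.GeneralisedArithmetic using (fold)
open import Data.Parity.Base as ℙ using (Parity; 0ℙ; 1ℙ)
import Data.Parity.Properties as ℙ
open import Data.Product using (_×_; _,_; proj₁; proj₂)
open import Data.Refinement using (value; _,_)
open import Data.Sum.Base using (_⊎_; inj₁; inj₂)
open import Data.Unit.Base using (tt)
open import Algebra.Properties.CommutativeSemigroup ℤ.+-commutativeSemigroup using (interchange)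
open import Relation.Binary.PropositionalEquality
open import Relation.Nullary.Decidable using (toWitness; ¬?)

-- Colour the lattice point (x , y) by the parity of x + y. This parity is additive, so translating
-- a tile shifts the colours of both ends of an edge by the same amount. Only the eight sides of `C`
-- in its four rotations remain, and these are checked by computation. The two colour classes form
-- the bipartition. For the lower bound, a tiling of the plane contains some tile, and any edge of
-- that tile needs two colours.

parity-suc-+-suc : ∀ m n → parity (suc m) ℙ.+ parity (suc n) ≡ parity m ℙ.+ parity n
parity-suc-+-suc m n = begin
  parity (suc m) ℙ.+ parity (suc n)  ≡⟨ ℙ.+-homo-+ (suc m) (suc n) ⟨
  parity (suc m ℕ.+ suc n)           ≡⟨ cong parity (ℕ.+-suc (suc m) n) ⟩
  parity (m ℕ.+ n)                   ≡⟨ ℙ.+-homo-+ m n ⟩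
  parity m ℙ.+ parity n              ∎
  where open ≡-Reasoning

-- Modulo 2 a difference is a sum: removing a successor from both arguments fixes the difference and
-- lowers the sum by 2.
parity-∣⊖∣ : ∀ m n → parity ∣ m ⊖ n ∣ ≡ parity m ℙ.+ parity n
parity-∣⊖∣ m       zero    = sym (ℙ.+-identityʳ (parity m))
parity-∣⊖∣ zero    (suc n) = refl
parity-∣⊖∣ (suc m) (suc n) = begin
  parity ∣ suc m ⊖ suc n ∣           ≡⟨ cong (λ i → parity ∣ i ∣) (ℤ.[1+m]⊖[1+n]≡m⊖n m n) ⟩
  parity ∣ m ⊖ n ∣                   ≡⟨ parity-∣⊖∣ m n ⟩
  parity m ℙ.+ parity n              ≡⟨ parity-suc-+-suc m n ⟨
  parity (suc m) ℙ.+ parity (suc n)  ∎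
  where open ≡-Reasoning

parity-∣+∣ : ∀ i j → parity ∣ i ℤ.+ j ∣ ≡ parity ∣ i ∣ ℙ.+ parity ∣ j ∣
parity-∣+∣ (+ m)    (+ n)    = ℙ.+-homo-+ m n
parity-∣+∣ (+ m)    -[1+ n ] = parity-∣⊖∣ m (suc n)
parity-∣+∣ -[1+ m ] (+ n)    = trans (parity-∣⊖∣ n (suc m)) (ℙ.+-comm (parity n) (parity (suc m)))
-- The absolute value here is `2 + (m + n)`, and `parity` discards the 2 by computation.
parity-∣+∣ -[1+ m ] -[1+ n ] = trans (ℙ.+-homo-+ m n) (sym (parity-suc-+-suc m n))

-- The chessboard colouring of the lattice; `∣_∣` serves to reach the naturals and preserves parity.
sumParity : Point → Parity
sumParity (x , y) = parity ∣ x ℤ.+ y ∣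

sumParity-⊕ : ∀ u v → sumParity (u ⊕ v) ≡ sumParity u ℙ.+ sumParity v
sumParity-⊕ (a , b) (c , d) =
  trans (cong (λ i → parity ∣ i ∣) (interchange a c b d)) (parity-∣+∣ (a ℤ.+ b) (c ℤ.+ d))

edge-sumParity : ∀ t {p q} → (p , q) ∈ edges t → sumParity p ≢ sumParity q
edge-sumParity t@(k , v) e with ∈-map⁻ (λ s → place t (proj₁ s) , place t (proj₂ s)) e
... | (p , q) , s∈ , refl = λ eq →
  -- Both ends carry the summand `sumParity v`; cancelling it leaves a side of the untranslated
  -- tile.
  All.lookup (turnedSides k) s∈ (ℙ.+-cancelˡ-≡ (sumParity v) _ _
    (trans (sym (sumParity-⊕ v (turned p))) (trans eq (sumParity-⊕ v (turned q)))))
  where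
  turned : Point → Point
  turned r = fold r turn (toℕ k)

  -- A closed statement about 4 × 8 turned sides, settled by the decision procedure.
  turnedSides : ∀ k → All (λ (p , q) → sumParity (fold p turn (toℕ k)) ≢ sumParity (fold q turn (toℕ k))) sides
  turnedSides = toWitness {a? = all? λ k → All.all? (λ (p , q) →
    ¬? (sumParity (fold p turn (toℕ k)) ℙ.≟ sumParity (fold q turn (toℕ k)))) sides} tt

toFin : Parity → Fin 2
toFin 0ℙ = 0F
toFin 1ℙ = 1F

toFin-injective : ∀ {p q} → toFin p ≡ toFin q → p ≡ q
toFin-injective {0ℙ} {0ℙ} _ = refl
toFin-injective {1ℙ} {1ℙ} _ = refl

graphOf-2-colourable : ∀ T → Colourable (graphOf T) 2
graphOf-2-colourable T = (λ v → toFin (sumParity (value v))) , λ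
  { (t , _ , inj₁ e) eq → edge-sumParity t e (toFin-injective eq)
  ; (t , _ , inj₂ e) eq → edge-sumParity t e (sym (toFin-injective eq)) }

module _ (G : Graph) where
  open Graph G

  2-colourable⇒bipartite : Colourable G 2 → Bipartite G
  2-colourable⇒bipartite (c , proper) = record
    { A         = λ v → c v ≡ 0F
    ; B         = λ v → c v ≡ 1F
    ; covers    = λ v → zero-or-one (c v)
    ; disjoint  = λ v (c≡0 , c≡1) → 0F≢1F (trans (sym c≡0) c≡1)
    ; no-edge-A = λ cu cv u~v → proper u~v (trans cu (sym cv))
    ; no-edge-B = λ cu cv u~v → proper u~v (trans cu (sym cv))
    }
    where
    zero-or-one : ∀ (i : Fin 2) → i ≡ 0F ⊎ i ≡ 1F
    zero-or-one 0F = inj₁ refl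
    zero-or-one 1F = inj₂ refl

    0F≢1F : _≢_ {A = Fin 2} 0F 1F
    0F≢1F ()

  -- With no colours `u` has no colour, and with one colour `u` and `v` agree.
  edge⇒2≤ : ∀ {u v} → u ~ v → ∀ m → Colourable G m → 2 ℕ.≤ m
  edge⇒2≤ {u} u~v zero    (c , _) with () ← c u
  edge⇒2≤ {u} {v} u~v 1   (c , proper) with c u | c v | proper u~v
  ... | 0F | 0F | c≢ = ⊥-elim (c≢ refl)
  edge⇒2≤ u~v (suc (suc m)) _ = s≤s (s≤s z≤n)

tile⇒2≤ : ∀ {T t} → T t → ∀ m → Colourable (graphOf T) m → 2 ℕ.≤ m
tile⇒2≤ {T} {t} t∈T = edge⇒2≤ (graphOf T)
  -- The ends of the first side of `t`, the images of (0 , 0) and (1 , 0).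
  {u = _ , [ t , t∈T , here refl ]} {v = _ , [ t , t∈T , there (here refl) ]}
  (t , t∈T , inj₁ (here refl))

mainTheorem2 : (T : Collection) → IsFixedPointTiling T →
    Bipartite (graphOf T) × Colourable (graphOf T) 2 × HasChromaticNumber (graphOf T) 2
mainTheorem2 T fixedPoint =
    2-colourable⇒bipartite (graphOf T) colouring
  , colouring
  , colouring
  -- The tile covering the cell at the origin supplies the edge.
  , tile⇒2≤ (proj₁ (proj₂ (IsTiling.covers (IsFixedPointTiling.isTiling fixedPoint) (0ℤ , 0ℤ))))
  where colouring = graphOf-2-colourable T
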